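{- Let $n\ge 1$. (I) Let $R=(r_1,\dots,r_n)$ and $S=(s_1,\dots,s_n)$ be vectors of nonnegative real numbers with $\sum_i r_i=\sum_j s_j$. Then $\mathcal{T}^{\pi/2}(R,S)\neq\emptyset$ if and only if (a) $R=S$, and (b) $R$ is palindromic, i.e. $r_i=r_{n+1-i}$ for all $i$. (II) Suppose in addition that $R$ and $S$ have nonnegative integer components. Then $\mathcal{T}^{\pi/2}_{\mathbb{Z}}(R,S)\neq\emptyset$ if and only if (a) and (b) hold as well as at least one of (c) $r_1+r_2+\dots+r_{\lfloor n/2\rfloor}$ is even, or (d) $n$ is odd and $r_{\lceil n/2\rceil}\ge 2$.
   Context: $\mathcal{T}(R,S)$ is the set of $n\times n$ matrices with nonnegative real entries whose $i$th row sum is $r_i$ and whose $j$th column sum is $s_j$ for all $i,j$. The counterclockwise rotation $\rho_{\pi/2}$ by $\pi/2$ acts on $n\times n$ matrices by $(\rho_{\pi/2}A)_{i,j}=a_{j,\,n+1-i}$. $\mathcal{T}^{\pi/2}(R,S)$ is the set of $A\in\mathcal{T}(R,S)$ with $\rho_{\pi/2}A=A$ (equivalently, invariant under the cyclic group generated by $\rho_{\pi/2}$); $\mathcal{T}^{\pi/2}_{\mathbb{Z}}(R,S)$ is the set of those $A\in\mathcal{T}^{\pi/2}(R,S)$ all of whose entries are integers. -}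

module Defs where

open import Algebra.Bundles using (CommutativeMonoid)
open import Data.Fin.Base using (Fin; toℕ; opposite; inject≤)
open import Data.Integer.Base using (ℤ; +_)
open import Data.Integer.Divisibility using (_∣_)
open import Data.Nat.Base as ℕ using (ℕ; suc; _⊔_; ⌊_/2⌋; ⌈_/2⌉)
import Data.Nat.Divisibility as ℕ
import Data.Nat.Properties as ℕ
open import Data.Product.Base using (_×_; _,_; ∃; ∃-syntax)
open import Data.Rational.Base as ℚ using (ℚ; 0ℚ; ½; ∣_∣)
import Data.Rational.Properties as ℚ
open import Data.Rational.Solver using (module +-*-Solver)
open import Data.Vec.Functional using (Vector; transpose)
open import Level using (0ℓ)
open import Relation.Binary.PropositionalEquality
  using (_≡_; refl; sym; trans; cong; cong₂; subst)
open import Relation.Unary using (Pred)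

-- The real numbers, as Cauchy sequences of rationals modulo _≈_.

IsCauchy : Pred (ℕ → ℚ) 0ℓ
IsCauchy x = ∀ ε → 0ℚ ℚ.< ε →
  ∃[ N ] (∀ m n → N ℕ.≤ m → N ℕ.≤ n → ∣ x m ℚ.- x n ∣ ℚ.< ε)

record ℝ : Set where
  constructor mkℝ
  field
    seq    : ℕ → ℚ
    cauchy : IsCauchy seq

open ℝ public

infix 4 _≈_ _≤_

_≈_ : ℝ → ℝ → Set
x ≈ y = ∀ ε → 0ℚ ℚ.< ε →
  ∃[ N ] (∀ n → N ℕ.≤ n → ∣ seq x n ℚ.- seq y n ∣ ℚ.< ε)

_≤_ : ℝ → ℝ → Set
x ≤ y = ∀ ε → 0ℚ ℚ.< ε →
  ∃[ N ] (∀ n → N ℕ.≤ n → seq x n ℚ.< seq y n ℚ.+ ε)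

private

  half : ℚ → ℚ
  half ε = ½ ℚ.* ε

  half>0 : ∀ {ε} → 0ℚ ℚ.< ε → 0ℚ ℚ.< half ε
  half>0 {ε} 0<ε = subst (ℚ._< half ε) (ℚ.*-zeroʳ ½) (ℚ.*-monoʳ-<-pos ½ 0<ε)

  half+half : ∀ ε → half ε ℚ.+ half ε ≡ ε
  half+half ε = trans (sym (ℚ.*-distribʳ-+ ε ½ ½)) (ℚ.*-identityˡ ε)

  ∣p-p∣<ε : ∀ p {ε} → 0ℚ ℚ.< ε → ∣ p ℚ.- p ∣ ℚ.< ε
  ∣p-p∣<ε p {ε} = subst (ℚ._< ε) (sym (cong ∣_∣ (ℚ.+-inverseʳ p)))

  ∣p-q∣≡∣q-p∣ : ∀ p q → ∣ p ℚ.- q ∣ ≡ ∣ q ℚ.- p ∣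
  ∣p-q∣≡∣q-p∣ p q = trans (cong ∣_∣ (lemma p q)) (ℚ.∣-p∣≡∣p∣ (q ℚ.- p))
    where
    open +-*-Solver
    lemma : ∀ p q → p ℚ.- q ≡ ℚ.- (q ℚ.- p)
    lemma = solve 2 (λ p q → p :- q := :- (q :- p)) refl

  ∣sum∣<ε : ∀ {a b c ε} → a ≡ b ℚ.+ c →
            ∣ b ∣ ℚ.< half ε → ∣ c ∣ ℚ.< half ε → ∣ a ∣ ℚ.< ε
  ∣sum∣<ε {b = b} {c} {ε} refl b< c< =
    subst (∣ b ℚ.+ c ∣ ℚ.<_) (half+half ε)
      (ℚ.≤-<-trans (ℚ.∣p+q∣≤∣p∣+∣q∣ b c) (ℚ.+-mono-< b< c<))

  telescope : ∀ p q r → p ℚ.- r ≡ (p ℚ.- q) ℚ.+ (q ℚ.- r)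
  telescope = solve 3 (λ p q r → p :- r := (p :- q) :+ (q :- r)) refl
    where open +-*-Solver

  interchange : ∀ p q r s →
    (p ℚ.+ q) ℚ.- (r ℚ.+ s) ≡ (p ℚ.- r) ℚ.+ (q ℚ.- s)
  interchange =
    solve 4 (λ p q r s → (p :+ q) :- (r :+ s) := (p :- r) :+ (q :- s)) refl
    where open +-*-Solver

≈-reflexive-seq : ∀ {x y} → (∀ n → seq x n ≡ seq y n) → x ≈ y
≈-reflexive-seq {x} {y} eq ε 0<ε = 0 , λ n _ →
  subst (λ q → ∣ q ℚ.- seq y n ∣ ℚ.< ε) (sym (eq n)) (∣p-p∣<ε (seq y n) 0<ε)

≈-refl : ∀ {x} → x ≈ x
≈-refl {x} = ≈-reflexive-seq {x} {x} λ _ → refl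

≈-sym : ∀ {x y} → x ≈ y → y ≈ x
≈-sym {x} {y} x≈y ε 0<ε with x≈y ε 0<ε
... | N , h = N , λ n N≤n →
  subst (ℚ._< ε) (∣p-q∣≡∣q-p∣ (seq x n) (seq y n)) (h n N≤n)

≈-trans : ∀ {x y z} → x ≈ y → y ≈ z → x ≈ z
≈-trans {x} {y} {z} x≈y y≈z ε 0<ε
  with x≈y (half ε) (half>0 0<ε) | y≈z (half ε) (half>0 0<ε)
... | M , f | N , g = M ⊔ N , λ n M⊔N≤n →
  ∣sum∣<ε (telescope (seq x n) (seq y n) (seq z n))
    (f n (ℕ.m⊔n≤o⇒m≤o M N M⊔N≤n)) (g n (ℕ.m⊔n≤o⇒n≤o M N M⊔N≤n))

fromℚ : ℚ → ℝ
fromℚ q = mkℝ (λ _ → q) λ ε 0<ε → 0 , λ _ _ _ _ → ∣p-p∣<ε q 0<ε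

fromℤ : ℤ → ℝ
fromℤ z = fromℚ (z ℚ./ 1)

0ℝ : ℝ
0ℝ = fromℚ 0ℚ

infixl 6 _+_

_+_ : ℝ → ℝ → ℝ
seq    (x + y) n = seq x n ℚ.+ seq y n
cauchy (x + y) ε 0<ε
  with cauchy x (half ε) (half>0 0<ε) | cauchy y (half ε) (half>0 0<ε)
... | M , f | N , g = M ⊔ N , λ m n ≤m ≤n →
  ∣sum∣<ε (interchange (seq x m) (seq y m) (seq x n) (seq y n))
    (f m n (ℕ.m⊔n≤o⇒m≤o M N ≤m) (ℕ.m⊔n≤o⇒m≤o M N ≤n))
    (g m n (ℕ.m⊔n≤o⇒n≤o M N ≤m) (ℕ.m⊔n≤o⇒n≤o M N ≤n))

+-cong : ∀ {x y u v} → x ≈ y → u ≈ v → x + u ≈ y + v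
+-cong {x} {y} {u} {v} x≈y u≈v ε 0<ε
  with x≈y (half ε) (half>0 0<ε) | u≈v (half ε) (half>0 0<ε)
... | M , f | N , g = M ⊔ N , λ n M⊔N≤n →
  ∣sum∣<ε (interchange (seq x n) (seq u n) (seq y n) (seq v n))
    (f n (ℕ.m⊔n≤o⇒m≤o M N M⊔N≤n)) (g n (ℕ.m⊔n≤o⇒n≤o M N M⊔N≤n))

+-0-commutativeMonoid : CommutativeMonoid 0ℓ 0ℓ
+-0-commutativeMonoid = record
  { Carrier = ℝ
  ; _≈_     = _≈_
  ; _∙_     = _+_
  ; ε       = 0ℝ
  ; isCommutativeMonoid = record
    { isMonoid = record
      { isSemigroup = record
        { isMagma = record
          { isEquivalence = record
            { refl  = λ {x} → ≈-refl {x}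
            ; sym   = λ {x} {y} → ≈-sym {x} {y}
            ; trans = λ {x} {y} {z} → ≈-trans {x} {y} {z}
            }
          ; ∙-cong = λ {x} {y} {u} {v} → +-cong {x} {y} {u} {v}
          }
        ; assoc = λ x y z → ≈-reflexive-seq {(x + y) + z} {x + (y + z)}
            λ n → ℚ.+-assoc (seq x n) (seq y n) (seq z n)
        }
      ; identity =
          (λ x → ≈-reflexive-seq {0ℝ + x} {x} λ n → ℚ.+-identityˡ (seq x n))
        , (λ x → ≈-reflexive-seq {x + 0ℝ} {x} λ n → ℚ.+-identityʳ (seq x n))
      }
    ; comm = λ x y → ≈-reflexive-seq {x + y} {y + x}
        λ n → ℚ.+-comm (seq x n) (seq y n)
    }
  }

open import Algebra.Properties.CommutativeMonoid.Sum +-0-commutativeMonoid public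
  using (sum)
open import Data.Vec.Functional.Relation.Binary.Equality.Setoid
  (CommutativeMonoid.setoid +-0-commutativeMonoid) public
  using (_≋_)

IsInteger : Pred ℝ 0ℓ
IsInteger x = ∃[ z ] x ≈ fromℤ z

IsEven : Pred ℝ 0ℓ
IsEven x = ∃[ z ] (x ≈ fromℤ z × + 2 ∣ z)

Matrix : ℕ → Set
Matrix n = Vector (Vector ℝ n) n

module _ {n : ℕ} where

  infix 4 _≋ₘ_

  _≋ₘ_ : Matrix n → Matrix n → Set
  A ≋ₘ B = ∀ i → A i ≋ B i

  -- opposite sends the 1-based index i to n + 1 - i.
  ρ : Matrix n → Matrix n
  ρ A i j = A j (opposite i)

  Nonnegative : Pred (Vector ℝ n) 0ℓ
  Nonnegative R = ∀ i → 0ℝ ≤ R i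

  Integral : Pred (Vector ℝ n) 0ℓ
  Integral R = ∀ i → IsInteger (R i)

  Palindromic : Pred (Vector ℝ n) 0ℓ
  Palindromic R = ∀ i → R i ≈ R (opposite i)

  record 𝒯 (R S : Vector ℝ n) (A : Matrix n) : Set where
    field
      nonnegative : ∀ i → Nonnegative (A i)
      rowSums     : ∀ i → sum (A i) ≈ R i
      columnSums  : ∀ j → sum (transpose A j) ≈ S j

  𝒯^π/2 : Vector ℝ n → Vector ℝ n → Pred (Matrix n) 0ℓ
  𝒯^π/2 R S A = 𝒯 R S A × ρ A ≋ₘ A

  𝒯ℤ^π/2 : Vector ℝ n → Vector ℝ n → Pred (Matrix n) 0ℓ
  𝒯ℤ^π/2 R S A = 𝒯^π/2 R S A × (∀ i → Integral (A i))

  firstHalfSum : Vector ℝ n → ℝ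
  firstHalfSum R = sum λ (i : Fin ⌊ n /2⌋) → R (inject≤ i (ℕ.⌊n/2⌋≤n n))

  -- suc (toℕ i) is the 1-based index of i, so i is the unique position ⌈n/2⌉.
  OddWithMiddle≥2 : Pred (Vector ℝ n) 0ℓ
  OddWithMiddle≥2 R =
    2 ℕ.∤ n × ∃[ i ] (suc (toℕ i) ≡ ⌈ n /2⌉ × fromℤ (+ 2) ≤ R i)

{-# OPTIONS --safe #-}
module Submission where

-- Invariance makes row sums, column sums and the reversed row sums agree.  Conversely, for palindromic R
-- the matrix carrying R/2 on the diagonal and on the antidiagonal is invariant with row sums R.
--
-- In the integral case, let k = ⌊n/2⌋.  The upper left and upper right k × k blocks have the same total, so
-- r₁ + ⋯ + r_k is even up to the total t of the upper half of the central column (if any), and the central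
-- row sums to at least 2t.  Conversely, the rotation orbit of a unit at (x , y) adds p_x + p_y to the row
-- sums, where p_x = e_x + e_{n+1-x}.  A palindromic R is the sum of r₁ + ⋯ + r_k vectors p_x with x ≤ k
-- and, for odd n, a multiple of e_c with c central; the p_x are paired off, a leftover one being
-- paired with p_c = 2 e_c.

open import Algebra.Bundles using (CommutativeMonoid)
import Algebra.Properties.CommutativeMonoid.Sum as Sum
import Algebra.Properties.Semiring.Sum as SemiringSum
open import Data.Bool.Base using (if_then_else_)
open import Data.Fin.Base using (Fin; zero; suc; toℕ; opposite; inject≤; inject₁; fromℕ)
open import Data.Fin.Permutation using (reverse)
open import Data.Fin.Properties
  using (_≟_; opposite-involutive; toℕ-inject≤; toℕ-inject₁; toℕ-injective)
import Data.List.Base as List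
import Data.Integer.Base as ℤ
import Data.Integer.Properties as ℤ
open import Data.List.Base using (List; []; _∷_; _++_; length)
open import Data.List.Properties using (map-++)
open import Data.Nat.Base using (ℕ; NonZero; zero; suc; s≤s; z≤n; ⌊_/2⌋; ⌈_/2⌉)
import Data.Nat.Base as ℕ
import Data.Nat.Divisibility as ℕ
import Data.Nat.ListAction as ListAction
open import Data.Nat.ListAction.Properties using (sum-++)
import Data.Nat.Properties as ℕ
open import Data.Nat.Tactic.RingSolver using (solve-∀)
open import Data.Product.Base using (_×_; _,_; proj₁; proj₂; ∃-syntax)
open import Data.Rational.Base using (ℚ; 0ℚ; ½; ∣_∣)
import Data.Rational.Base as ℚ
import Data.Rational.Literals as Literals
import Data.Rational.Properties as ℚ
open import Data.Rational.Solver using (module +-*-Solver)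
open import Data.Sum.Base using (_⊎_; inj₁; inj₂)
open import Data.Vec.Functional using (Vector; tail)
open import Function.Base using (_∘_; flip)
open import Function.Bundles using (_⇔_; mk⇔)
open import Relation.Binary.PropositionalEquality as ≡
  using (_≡_; cong; cong₂; subst; module ≡-Reasoning)
open import Relation.Nullary using (does; yes; no; contradiction)
open import Relation.Nullary.Decidable using (does-⇔)
open import Relation.Unary using (Satisfiable)

-- Rotation-invariant matrices over a commutative monoid.

module _ {c ℓ} (M : CommutativeMonoid c ℓ) where
  open CommutativeMonoid M
  open Sum M using (sum; sum-cong-≋; sum-permute; sum-replicate-zero; ∑-distrib-+)
  open import Relation.Binary.Reasoning.Setoid setoid

  single : ∀ {n} → Carrier → Fin n → Vector Carrier n
  single x i j = if does (i ≟ j) then x else ε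

  sum-single : ∀ {n} x (i : Fin n) → sum (single x i) ≈ x
  sum-single {suc n} x zero    = trans (∙-congˡ (sum-replicate-zero n)) (identityʳ x)
  sum-single {suc n} x (suc i) = trans (identityˡ _) (sum-single x i)

  single-sym : ∀ {n} x (i j : Fin n) → single x i j ≡ single x j i
  single-sym x i j = ≡.cong (if_then x else ε)
    (does-⇔ (mk⇔ ≡.sym ≡.sym) (i ≟ j) (j ≟ i))

  single-opposite : ∀ {n} x (i j : Fin n) → single x (opposite i) j ≡ single x i (opposite j)
  single-opposite x i j = ≡.cong (if_then x else ε)
    (does-⇔ (mk⇔ (flipOpposite i j) (≡.sym ∘ flipOpposite j i ∘ ≡.sym)) (opposite i ≟ j) (i ≟ opposite j))
    where
    flipOpposite : ∀ {n} (i j : Fin n) → opposite i ≡ j → i ≡ opposite j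
    flipOpposite i _ ≡.refl = ≡.sym (opposite-involutive i)

  -- Off the position `i ≡ j` both sides are `ε`, so the values need to agree only there. This lets
  -- `diagonals-invariant` replace `x j` by `x i` exactly where the two are related.
  single-cong : ∀ {n} {x y} (i j : Fin n) → (i ≡ j → x ≈ y) → single x i j ≈ single y i j
  single-cong i j x≈y with i ≟ j
  ... | yes i≡j = x≈y i≡j
  ... | no _    = refl

  -- The two diagonals are added rather than united. When `opposite i ≡ i` both terms fall on the
  -- same entry, so the central row also sums to `x i ∙ x i` and no case distinction on parity
  -- arises.
  diagonals : ∀ {n} → Vector Carrier n → Fin n → Fin n → Carrier
  diagonals x i j = single (x i) i j ∙ single (x i) i (opposite j)

  diagonals-rowSum : ∀ {n} (x : Vector Carrier n) i → sum (diagonals x i) ≈ x i ∙ x i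
  diagonals-rowSum x i = begin
    sum (diagonals x i)
      ≈⟨ ∑-distrib-+ (single (x i) i) (single (x i) i ∘ opposite) ⟩
    sum (single (x i) i) ∙ sum (single (x i) i ∘ opposite)
      ≈⟨ ∙-congˡ (sum-permute (single (x i) i) reverse) ⟨
    sum (single (x i) i) ∙ sum (single (x i) i)
      ≈⟨ ∙-cong (sum-single (x i) i) (sum-single (x i) i) ⟩
    x i ∙ x i ∎

  -- The rotation exchanges the diagonal with the antidiagonal, which `comm` undoes. It also moves
  -- the value `x j` into row `i`: on the diagonal `i` is `j`, and on the antidiagonal `i` is
  -- `opposite j`, where palindromicity applies.
  diagonals-invariant : ∀ {n} (x : Vector Carrier n) → (∀ i → x i ≈ x (opposite i)) →
    ∀ i j → diagonals x j (opposite i) ≈ diagonals x i j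
  diagonals-invariant x palindromic i j = begin
    single (x j) j (opposite i) ∙ single (x j) j (opposite (opposite i))
      ≡⟨ ≡.cong₂ _∙_
           (≡.trans (≡.sym (single-opposite (x j) j i)) (single-sym (x j) (opposite j) i))
           (≡.trans (≡.cong (single (x j) j) (opposite-involutive i)) (single-sym (x j) j i)) ⟩
    single (x j) i (opposite j) ∙ single (x j) i j
      ≈⟨ ∙-cong (single-cong i (opposite j) λ { ≡.refl → palindromic j })
                (single-cong i j λ { ≡.refl → refl }) ⟩
    single (x i) i (opposite j) ∙ single (x i) i j
      ≈⟨ comm _ _ ⟩
    single (x i) i j ∙ single (x i) i (opposite j) ∎

  module _ {n} (A : Fin n → Fin n → Carrier)
           (invariant : ∀ i j → A j (opposite i) ≈ A i j) where

    -- Invariance reads column `j` as row `j` in reverse order, and reversal permutes the summands.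
    columnSum≈rowSum : ∀ j → sum (λ i → A i j) ≈ sum (A j)
    columnSum≈rowSum j = begin
      sum (λ i → A i j)            ≈⟨ sum-cong-≋ (λ i → sym (invariant i j)) ⟩
      sum (λ i → A j (opposite i)) ≈⟨ sum-permute (A j) reverse ⟨
      sum (A j)                    ∎

    -- The same identity, with the row index held fixed, reads row `i` as column `opposite i`; that
    -- column has the sum of row `opposite i`.
    rowSum-palindromic : ∀ i → sum (A i) ≈ sum (A (opposite i))
    rowSum-palindromic i = begin
      sum (A i)                    ≈⟨ sum-cong-≋ (λ j → sym (invariant i j)) ⟩
      sum (λ j → A j (opposite i)) ≈⟨ columnSum≈rowSum (opposite i) ⟩
      sum (A (opposite i))         ∎

-- Splitting an index range into two halves and a centre.

module _ where
  open import Data.Nat.Base using (_+_; _*_; _∸_; _≤_)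
  open ≡ using (refl; sym; trans)
  open SemiringSum ℕ.+-*-semiring
    using (sum; sum-cong-≗; sum-permute; sum-init-last; sum-replicate-zero; ∑-distrib-+; ∑-comm; *-distribˡ-sum)
  open ≡-Reasoning

  -- This is the embedding used in `firstHalfSum`, so sums over `lower` agree with it
  -- definitionally.
  lower : ∀ {n} → Fin ⌊ n /2⌋ → Fin n
  lower {n} i = inject≤ i (ℕ.⌊n/2⌋≤n n)

  lower-suc : ∀ {n} (i : Fin ⌊ n /2⌋) → lower {suc (suc n)} (suc i) ≡ suc (inject₁ (lower i))
  lower-suc {n} i = cong suc (toℕ-injective (begin
    toℕ (inject≤ i _)      ≡⟨ toℕ-inject≤ i _ ⟩
    toℕ i                  ≡⟨ toℕ-inject≤ i (ℕ.⌊n/2⌋≤n n) ⟨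
    toℕ (lower i)          ≡⟨ toℕ-inject₁ (lower i) ⟨
    toℕ (inject₁ (lower i)) ∎))

  opposite-inject₁ : ∀ {n} (i : Fin n) → opposite (inject₁ i) ≡ suc (opposite i)
  opposite-inject₁ zero    = refl
  opposite-inject₁ (suc i) = cong inject₁ (opposite-inject₁ i)

  halves : ∀ {n} → (Fin n → ℕ) → ℕ
  halves f = sum (f ∘ lower) + sum (f ∘ opposite ∘ lower)

  -- The splitting holds for every `f` at once, so a single parity analysis of `n` serves matrix
  -- rows as well as vectors of multiplicities.
  data Centre (n : ℕ) : Set where
    even : 2 ℕ.∣ n → (∀ f → sum {n} f ≡ halves f) → Centre n
    odd  : 2 ℕ.∤ n → (c : Fin n) → suc (toℕ c) ≡ ⌈ n /2⌉ → opposite c ≡ c →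
           (∀ f → sum {n} f ≡ halves f + f c) → Centre n

  inner : ∀ {n} → (Fin (suc (suc n)) → ℕ) → Fin n → ℕ
  inner f = f ∘ suc ∘ inject₁

  sum-border : ∀ {n} (f : Fin (suc (suc n)) → ℕ) →
    sum f ≡ f zero + (sum (inner f) + f (fromℕ (suc n)))
  sum-border f = cong (f zero +_) (sum-init-last (tail f))

  halves-border : ∀ {n} (f : Fin (suc (suc n)) → ℕ) →
    halves f ≡ f zero + (halves (inner f) + f (fromℕ (suc n)))
  halves-border {n} f = begin
    (f zero + sum (f ∘ lower ∘ suc)) + (f (fromℕ (suc n)) + sum (f ∘ opposite ∘ lower ∘ suc))
      ≡⟨ cong₂ (λ u v → (f zero + u) + (f (fromℕ (suc n)) + v))
           (sum-cong-≗ (λ i → cong f (lower-suc {n} i)))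
           (sum-cong-≗ (λ i → cong f (trans (cong opposite (lower-suc {n} i))
             (cong inject₁ (opposite-inject₁ (lower {n} i)))))) ⟩
    (f zero + u) + (f (fromℕ (suc n)) + v)
      ≡⟨ rearrange (f zero) u (f (fromℕ (suc n))) v ⟩
    f zero + ((u + v) + f (fromℕ (suc n))) ∎
    where
    u v : ℕ
    u = sum (inner f ∘ lower)
    v = sum (inner f ∘ opposite ∘ lower)
    rearrange : ∀ a b c d → (a + b) + (c + d) ≡ a + ((b + d) + c)
    rearrange = solve-∀

  -- Induction in steps of two, removing the first and the last index. By `sum-border` and
  -- `halves-border` both sides of the splitting gain the same two end terms, and the centre moves
  -- inwards as `suc (inject₁ c)`.
  centre : ∀ n → Centre n
  centre 0 = even (ℕ._∣0 2) λ f → refl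
  centre 1 = odd (λ 2∣1 → contradiction (ℕ.∣⇒≤ 2∣1) λ { (s≤s ()) }) zero refl refl
    λ f → ℕ.+-identityʳ (f zero)
  centre (suc (suc n)) with centre n
  ... | even 2∣n split = even (ℕ.∣m∣n⇒∣m+n ℕ.∣-refl 2∣n) λ f → begin
    sum f                                   ≡⟨ sum-border f ⟩
    f zero + (sum (inner f) + _)  ≡⟨ cong (λ s → f zero + (s + f (fromℕ (suc n)))) (split (inner f)) ⟩
    f zero + (halves (inner f) + _) ≡⟨ halves-border f ⟨
    halves f                                ∎
  ... | odd 2∤n c at fixed split =
    odd (λ 2∣2+n → 2∤n (ℕ.∣m+n∣m⇒∣n 2∣2+n ℕ.∣-refl)) (suc (inject₁ c))
      (cong suc (trans (cong suc (toℕ-inject₁ c)) at))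
      (trans (cong inject₁ (opposite-inject₁ c)) (cong (λ i → suc (inject₁ i)) fixed)) λ f → begin
    sum f                                   ≡⟨ sum-border f ⟩
    f zero + (sum (inner f) + _)  ≡⟨ cong (λ s → f zero + (s + f (fromℕ (suc n)))) (split (inner f)) ⟩
    f zero + (halves (inner f) + f (suc (inject₁ c)) + _)
      ≡⟨ rearrange (f zero) (halves (inner f)) _ _ ⟩
    f zero + (halves (inner f) + _) + f (suc (inject₁ c))
      ≡⟨ cong (_+ f (suc (inject₁ c))) (halves-border f) ⟨
    halves f + f (suc (inject₁ c)) ∎
    where
    rearrange : ∀ a b c d → a + (b + c + d) ≡ a + (b + d) + c
    rearrange = solve-∀

  2∣m+m : ∀ m → 2 ℕ.∣ m + m
  2∣m+m m = ℕ.divides m (trans (cong (m +_) (sym (ℕ.+-identityʳ m))) (ℕ.*-comm 2 m))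

  -- Necessity of the parity condition over the naturals.

  RotationInvariant : ∀ {n} → (Fin n → Fin n → ℕ) → Set
  RotationInvariant a = ∀ i j → a j (opposite i) ≡ a i j

  module _ {n} (a : Fin n → Fin n → ℕ) (invariant : RotationInvariant a) where

    private
      corner : ℕ
      corner = sum λ i → sum λ j → a (lower i) (lower j)

    -- Entry `(i , opposite j)` of the upper right block equals entry `(j , i)` of the upper left
    -- one. The indices come out exchanged, hence the use of `∑-comm`.
    upper-halves : sum (λ i → halves (a (lower i))) ≡ corner + corner
    upper-halves = begin
      sum (λ i → halves (a (lower i)))
        ≡⟨ ∑-distrib-+ (λ i → sum (a (lower i) ∘ lower)) (λ i → sum (a (lower i) ∘ opposite ∘ lower)) ⟩
      corner + sum (λ i → sum λ j → a (lower i) (opposite (lower j)))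
        ≡⟨ cong (corner +_) (sum-cong-≗ λ i → sum-cong-≗ λ j → invariant (lower j) (lower i)) ⟩
      corner + sum (λ i → sum λ j → a (lower j) (lower i))
        ≡⟨ cong (corner +_) (∑-comm λ i j → a (lower j) (lower i)) ⟩
      corner + corner ∎

    -- Both halves of the central row are rotations of the upper arm of the central column. One use
    -- of `invariant` reaches it from the right arm; three are needed from the left arm, passing
    -- through the lower and the right arms.
    centre-row : ∀ c → opposite c ≡ c →
      halves (a c) ≡ sum (λ i → a (lower i) c) + sum (λ i → a (lower i) c)
    centre-row c fixed = cong₂ _+_
      (sum-cong-≗ λ i → begin
        a c (lower i)                       ≡⟨ cong (a c) (opposite-involutive (lower i)) ⟨
        a c (opposite (opposite (lower i))) ≡⟨ invariant (opposite (lower i)) c ⟩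
        a (opposite (lower i)) c            ≡⟨ cong (a _) fixed ⟨
        a (opposite (lower i)) (opposite c) ≡⟨ invariant c (opposite (lower i)) ⟩
        a c (opposite (lower i))            ≡⟨ invariant (lower i) c ⟩
        a (lower i) c                       ∎)
      (sum-cong-≗ λ i → invariant (lower i) c)

    upper-even⊎centre≥2 :
      2 ℕ.∣ sum (λ i → sum (a (lower i))) ⊎
      (2 ℕ.∤ n × ∃[ c ] (suc (toℕ c) ≡ ⌈ n /2⌉ × 2 ≤ sum (a c)))
    upper-even⊎centre≥2 with centre n
    ... | even _ split = inj₁ (subst (2 ℕ.∣_)
      (sym (trans (sum-cong-≗ λ i → split (a (lower i))) upper-halves)) (2∣m+m corner))
    -- The case distinction is on the total of the upper arm, not on the parity of the upper half.
    -- If it vanishes, the upper half is `corner + corner`; if it is positive, the central row sum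
    -- is at least 2 whatever that parity is.
    ... | odd 2∤n c at fixed split with sum (λ i → a (lower i) c) in arm
    ... | zero = inj₁ (subst (2 ℕ.∣_) (begin
      corner + corner
        ≡⟨ upper-halves ⟨
      sum (λ i → halves (a (lower i)))
        ≡⟨ ℕ.+-identityʳ _ ⟨
      sum (λ i → halves (a (lower i))) + 0
        ≡⟨ cong (_ +_) arm ⟨
      sum (λ i → halves (a (lower i))) + sum (λ i → a (lower i) c)
        ≡⟨ ∑-distrib-+ (λ i → halves (a (lower i))) (λ i → a (lower i) c) ⟨
      sum (λ i → halves (a (lower i)) + a (lower i) c)
        ≡⟨ sum-cong-≗ (λ i → split (a (lower i))) ⟨
      sum (λ i → sum (a (lower i))) ∎) (2∣m+m corner))
    ... | suc k = inj₂ (2∤n , c , at , (ℕ.≤-Reasoning.begin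
      2                           ℕ.≤-Reasoning.≤⟨ ℕ.+-mono-≤ (s≤s z≤n) (s≤s z≤n) ⟩
      suc k + suc k               ℕ.≤-Reasoning.≡⟨ cong (λ m → m + m) arm ⟨
      _                           ℕ.≤-Reasoning.≡⟨ centre-row c fixed ⟨
      halves (a c)                ℕ.≤-Reasoning.≤⟨ ℕ.m≤m+n _ (a c c) ⟩
      halves (a c) + a c c        ℕ.≤-Reasoning.≡⟨ split (a c) ⟨
      sum (a c)                   ℕ.≤-Reasoning.∎))

  -- Building blocks: orbits of units and central entries.

  Realizable : ∀ {n} → (Fin n → ℕ) → Set
  Realizable r = ∃[ a ] (RotationInvariant a × (∀ i → sum (a i) ≡ r i))

  realizable-cong : ∀ {n} {r s : Fin n → ℕ} → (∀ i → r i ≡ s i) → Realizable r → Realizable s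
  realizable-cong r≗s (a , invariant , rows) = a , invariant , λ i → trans (rows i) (r≗s i)

  realizable-+ : ∀ {n} {r s : Fin n → ℕ} →
    Realizable r → Realizable s → Realizable (λ i → r i + s i)
  realizable-+ (a , a-invariant , a-rows) (b , b-invariant , b-rows) =
    (λ i j → a i j + b i j) ,
    (λ i j → cong₂ _+_ (a-invariant i j) (b-invariant i j)) ,
    λ i → trans (∑-distrib-+ (a i) (b i)) (cong₂ _+_ (a-rows i) (b-rows i))

  realizable-0 : ∀ {n} → Realizable {n} (λ _ → 0)
  realizable-0 {n} = (λ _ _ → 0) , (λ _ _ → refl) , λ _ → sum-replicate-zero n

  -- For `u = unit x` this is the vector p_x; when `opposite x ≡ x` the index is counted twice,
  -- giving twice `unit x`.
  symmetrised : ∀ {n} → (Fin n → ℕ) → Fin n → ℕ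
  symmetrised u i = u i + u (opposite i)

  -- The four summands are the rotations of the rank one matrix u vᵀ.
  realizable-orbit : ∀ {n} (u v : Fin n → ℕ) → sum u ≡ 1 → sum v ≡ 1 →
    Realizable (λ i → symmetrised u i + symmetrised v i)
  realizable-orbit {n} u v ∑u≡1 ∑v≡1 = a , invariant , rows
    where
    a : Fin n → Fin n → ℕ
    a i j = (u i * v j + v (opposite i) * u j) +
      (u (opposite i) * v (opposite j) + v i * u (opposite j))

    invariant : RotationInvariant a
    invariant i j rewrite opposite-involutive i =
      rotate (u j) (v (opposite i)) (v (opposite j)) (u (opposite i)) (u (opposite j)) (v i) (v j) (u i)
      where
      rotate : ∀ p q r s t w x y →
        (p * q + r * s) + (t * w + x * y) ≡ (y * x + q * p) + (s * r + w * t)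
      rotate = solve-∀

    ∑ᵒ : ∀ w → sum w ≡ 1 → sum (w ∘ opposite) ≡ 1
    ∑ᵒ w = trans (sym (sum-permute w reverse))

    scale : ∀ m (w : Fin n → ℕ) → sum w ≡ 1 → sum (λ j → m * w j) ≡ m
    scale m w ∑w≡1 = begin
      sum (λ j → m * w j) ≡⟨ *-distribˡ-sum m w ⟨
      m * sum w           ≡⟨ cong (m *_) ∑w≡1 ⟩
      m * 1               ≡⟨ ℕ.*-identityʳ m ⟩
      m                   ∎

    rows : ∀ i → sum (a i) ≡ symmetrised u i + symmetrised v i
    rows i = begin
      sum (a i)
        ≡⟨ ∑-distrib-+ (λ j → u i * v j + v (opposite i) * u j) _ ⟩
      sum (λ j → u i * v j + v (opposite i) * u j) +
      sum (λ j → u (opposite i) * v (opposite j) + v i * u (opposite j))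
        ≡⟨ cong₂ _+_
             (trans (∑-distrib-+ (λ j → u i * v j) _)
               (cong₂ _+_ (scale (u i) v ∑v≡1) (scale (v (opposite i)) u ∑u≡1)))
             (trans (∑-distrib-+ (λ j → u (opposite i) * v (opposite j)) _)
               (cong₂ _+_ (scale (u (opposite i)) _ (∑ᵒ v ∑v≡1)) (scale (v i) _ (∑ᵒ u ∑u≡1)))) ⟩
      (u i + v (opposite i)) + (u (opposite i) + v i)
        ≡⟨ regroup (u i) (v (opposite i)) (u (opposite i)) (v i) ⟩
      symmetrised u i + symmetrised v i ∎
      where
      regroup : ∀ p q r s → (p + q) + (r + s) ≡ (p + r) + (s + q)
      regroup = solve-∀

  unit : ∀ {n} → Fin n → Fin n → ℕ
  unit = single ℕ.+-0-commutativeMonoid 1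

  sum-unit : ∀ {n} (i : Fin n) → sum (unit i) ≡ 1
  sum-unit = sum-single ℕ.+-0-commutativeMonoid 1

  unit-fixed : ∀ {n} (c : Fin n) → opposite c ≡ c → ∀ i → unit c (opposite i) ≡ unit c i
  unit-fixed c fixed i =
    trans (sym (single-opposite ℕ.+-0-commutativeMonoid 1 c i)) (cong (flip unit i) fixed)

  -- The matrix has `m` at `(c , c)` and zeros elsewhere; the rotation fixes that position because
  -- `opposite c ≡ c`.
  realizable-centre : ∀ {n} (c : Fin n) → opposite c ≡ c → ∀ m →
    Realizable (λ i → m * unit c i)
  realizable-centre c fixed m = (λ i j → m * unit c i * unit c j) , invariant , rows
    where
    invariant : RotationInvariant (λ i j → m * unit c i * unit c j)
    invariant i j = trans (cong (m * unit c j *_) (unit-fixed c fixed i)) (swap m (unit c j) (unit c i))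
      where
      swap : ∀ p q r → p * q * r ≡ p * r * q
      swap = solve-∀

    rows : ∀ i → sum (λ j → m * unit c i * unit c j) ≡ m * unit c i
    rows i = begin
      sum (λ j → m * unit c i * unit c j) ≡⟨ *-distribˡ-sum (m * unit c i) (unit c) ⟨
      m * unit c i * sum (unit c)         ≡⟨ cong (m * unit c i *_) (sum-unit c) ⟩
      m * unit c i * 1                    ≡⟨ ℕ.*-identityʳ _ ⟩
      m * unit c i                        ∎

  -- Lists of units and their pairing.

  listSum : ∀ {A : Set} → (A → ℕ) → List A → ℕ
  listSum g xs = ListAction.sum (List.map g xs)

  -- One orbit accounts for two consecutive members of the list, whichever they are, so nothing but
  -- the parity of the length matters.
  realizable-pairs : ∀ {n} (xs : List (Fin n)) → 2 ℕ.∣ length xs →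
    Realizable (λ i → listSum (λ x → symmetrised (unit x) i) xs)
  realizable-pairs []           _ = realizable-0
  realizable-pairs (_ ∷ [])     2∣1 = contradiction (ℕ.∣⇒≤ 2∣1) λ { (s≤s ()) }
  realizable-pairs (x ∷ y ∷ xs) 2∣2+m = realizable-cong
    (λ i → ℕ.+-assoc (symmetrised (unit x) i) (symmetrised (unit y) i) _)
    (realizable-+ (realizable-orbit (unit x) (unit y) (sum-unit x) (sum-unit y))
      (realizable-pairs xs (ℕ.∣m+n∣m⇒∣n 2∣2+m ℕ.∣-refl)))

  listSum-replicate : ∀ {A : Set} (g : A → ℕ) m x → listSum g (List.replicate m x) ≡ m * g x
  listSum-replicate g zero    x = refl
  listSum-replicate g (suc m) x = cong (g x +_) (listSum-replicate g m x)

  listSum-1 : ∀ {A : Set} (xs : List A) → listSum (λ _ → 1) xs ≡ length xs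
  listSum-1 []       = refl
  listSum-1 (x ∷ xs) = cong suc (listSum-1 xs)

  -- A multiset with multiplicities `m`, written out as a list so that its members can be taken two
  -- at a time.
  repeat : ∀ {A : Set} {k} → (Fin k → ℕ) → (Fin k → A) → List A
  repeat {k = zero}  m x = []
  repeat {k = suc k} m x = List.replicate (m zero) (x zero) ++ repeat (m ∘ suc) (x ∘ suc)

  listSum-repeat : ∀ {A : Set} {k} (g : A → ℕ) (m : Fin k → ℕ) (x : Fin k → A) →
    listSum g (repeat m x) ≡ sum (λ i → m i * g (x i))
  listSum-repeat {k = zero}  g m x = refl
  listSum-repeat {k = suc k} g m x = begin
    listSum g (List.replicate (m zero) (x zero) ++ rest)
      ≡⟨ cong ListAction.sum (map-++ g (List.replicate (m zero) (x zero)) rest) ⟩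
    ListAction.sum (List.map g (List.replicate (m zero) (x zero)) ++ List.map g rest)
      ≡⟨ sum-++ (List.map g (List.replicate (m zero) (x zero))) (List.map g rest) ⟩
    listSum g (List.replicate (m zero) (x zero)) + listSum g rest
      ≡⟨ cong₂ _+_ (listSum-replicate g (m zero) (x zero)) (listSum-repeat g (m ∘ suc) (x ∘ suc)) ⟩
    sum (λ i → m i * g (x i)) ∎
    where
    rest = repeat (m ∘ suc) (x ∘ suc)

  length-repeat : ∀ {A : Set} {k} (m : Fin k → ℕ) (x : Fin k → A) → length (repeat m x) ≡ sum m
  length-repeat m x = begin
    length (repeat m x)          ≡⟨ listSum-1 (repeat m x) ⟨
    listSum (λ _ → 1) (repeat m x) ≡⟨ listSum-repeat (λ _ → 1) m x ⟩
    sum (λ i → m i * 1)          ≡⟨ sum-cong-≗ (λ i → ℕ.*-identityʳ (m i)) ⟩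
    sum m                        ∎

  sum-units : ∀ {n} (r : Fin n → ℕ) j → sum (λ i → r i * unit i j) ≡ r j
  sum-units r j = trans (sum-cong-≗ (λ i → at i)) (sum-single ℕ.+-0-commutativeMonoid (r j) j)
    where
    at : ∀ i → r i * unit i j ≡ single ℕ.+-0-commutativeMonoid (r j) j i
    at i with i ≟ j | j ≟ i
    ... | yes refl | yes _ = ℕ.*-identityʳ (r i)
    ... | yes refl | no i≢i = contradiction refl i≢i
    ... | no i≢j | yes j≡i = contradiction (sym j≡i) i≢j
    ... | no _ | no _ = ℕ.*-zeroʳ (r i)

  -- Sufficiency: realizing a palindromic vector.

  module _ {n} (r : Fin n → ℕ) (palindromic : ∀ i → r i ≡ r (opposite i)) where

    lowerUnits : List (Fin n)
    lowerUnits = repeat (r ∘ lower) lower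

    -- By palindromicity an index and its opposite have the same multiplicity, so their unit vectors
    -- combine into `symmetrised (unit x)`, repeated as often as `x` occurs in `lowerUnits`.
    halves-units : ∀ j →
      halves (λ i → r i * unit i j) ≡ listSum (λ x → symmetrised (unit x) j) lowerUnits
    halves-units j = begin
      halves (λ i → r i * unit i j)
        ≡⟨ cong (sum (λ i → r (lower i) * unit (lower i) j) +_) (sum-cong-≗ λ i →
             cong₂ _*_ (sym (palindromic (lower i)))
                       (single-opposite ℕ.+-0-commutativeMonoid 1 (lower i) j)) ⟩
      sum (λ i → r (lower i) * unit (lower i) j) +
      sum (λ i → r (lower i) * unit (lower i) (opposite j))
        ≡⟨ ∑-distrib-+ (λ i → r (lower i) * unit (lower i) j) _ ⟨
      sum (λ i → r (lower i) * unit (lower i) j + r (lower i) * unit (lower i) (opposite j))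
        ≡⟨ sum-cong-≗ (λ i → ℕ.*-distribˡ-+ (r (lower i)) (unit (lower i) j) _) ⟨
      sum (λ i → r (lower i) * symmetrised (unit (lower i)) j)
        ≡⟨ listSum-repeat (λ x → symmetrised (unit x) j) (r ∘ lower) lower ⟨
      listSum (λ x → symmetrised (unit x) j) lowerUnits ∎

    2∣lowerUnits : 2 ℕ.∣ sum (r ∘ lower) → 2 ℕ.∣ length lowerUnits
    2∣lowerUnits = subst (2 ℕ.∣_) (sym (length-repeat (r ∘ lower) lower))

    2∤n⇒2∣1+n : ∀ n → 2 ℕ.∤ n → 2 ℕ.∣ suc n
    2∤n⇒2∣1+n 0 2∤n = contradiction (ℕ._∣0 2) 2∤n
    2∤n⇒2∣1+n 1 _ = ℕ.∣-refl
    2∤n⇒2∣1+n (suc (suc n)) 2∤n = ℕ.∣m∣n⇒∣m+n ℕ.∣-refl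
      (2∤n⇒2∣1+n n (2∤n ∘ ℕ.∣m∣n⇒∣m+n ℕ.∣-refl))

    -- The converse of `upper-even⊎centre≥2`, with the same disjunction stated for the prescribed
    -- row sums.
    palindromic-realizable :
      2 ℕ.∣ sum (r ∘ lower) ⊎ (2 ℕ.∤ n × ∃[ c ] (suc (toℕ c) ≡ ⌈ n /2⌉ × 2 ≤ r c)) →
      Realizable r
    private
      Fixed : Fin n → Set
      Fixed c = opposite c ≡ c × (∀ f → sum {n} f ≡ halves f + f c)

      -- Expand `r` in unit vectors and apply `split`: the two halves are collected by
      -- `halves-units`, and the central term remains.
      expand : ∀ {c} → Fixed c → ∀ j →
        listSum (λ x → symmetrised (unit x) j) lowerUnits + r c * unit c j ≡ r j
      expand {c} (_ , split) j = begin
        listSum (λ x → symmetrised (unit x) j) lowerUnits + r c * unit c j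
          ≡⟨ cong (_+ r c * unit c j) (halves-units j) ⟨
        halves (λ i → r i * unit i j) + r c * unit c j
          ≡⟨ split (λ i → r i * unit i j) ⟨
        sum (λ i → r i * unit i j)
          ≡⟨ sum-units r j ⟩
        r j ∎

      evenRealizable : ∀ {c} → Fixed c → 2 ℕ.∣ sum (r ∘ lower) → Realizable r
      evenRealizable {c} c-fixed 2∣∑ = realizable-cong (expand c-fixed)
        (realizable-+ (realizable-pairs lowerUnits (2∣lowerUnits 2∣∑))
                      (realizable-centre c (proj₁ c-fixed) (r c)))

      -- The unpaired unit is paired with the centre, at the cost of 2 in the centre row.
      oddRealizable : ∀ {c} → Fixed c → 2 ≤ r c → 2 ℕ.∤ sum (r ∘ lower) → Realizable r
      oddRealizable {c} c-fixed 2≤rc 2∤∑ = realizable-cong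
        (λ j → trans (absorb j) (expand c-fixed j))
        (realizable-+
          (realizable-pairs (c ∷ lowerUnits)
            (2∤n⇒2∣1+n _ (2∤∑ ∘ subst (2 ℕ.∣_) (length-repeat (r ∘ lower) lower))))
          (realizable-centre c (proj₁ c-fixed) (r c ∸ 2)))
        where
        rearrange : ∀ p q m → p + p + q + m * p ≡ q + (2 + m) * p
        rearrange = solve-∀

        absorb : ∀ j → let rest = listSum (λ x → symmetrised (unit x) j) lowerUnits in
          symmetrised (unit c) j + rest + (r c ∸ 2) * unit c j ≡ rest + r c * unit c j
        absorb j = let rest = listSum (λ x → symmetrised (unit x) j) lowerUnits in begin
          symmetrised (unit c) j + rest + (r c ∸ 2) * unit c j
            ≡⟨ cong (λ p → unit c j + p + rest + (r c ∸ 2) * unit c j) (unit-fixed c (proj₁ c-fixed) j) ⟩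
          unit c j + unit c j + rest + (r c ∸ 2) * unit c j
            ≡⟨ rearrange (unit c j) rest (r c ∸ 2) ⟩
          rest + (2 + (r c ∸ 2)) * unit c j
            ≡⟨ cong (λ m → rest + m * unit c j) (ℕ.m+[n∸m]≡n 2≤rc) ⟩
          rest + r c * unit c j ∎

    palindromic-realizable condition with centre n
    palindromic-realizable (inj₂ (2∤n , _)) | even 2∣n _ = contradiction 2∣n 2∤n
    palindromic-realizable (inj₁ 2∣∑) | even _ split =
      realizable-cong (λ j → trans (sym (halves-units j)) (trans (sym (split _)) (sum-units r j)))
        (realizable-pairs lowerUnits (2∣lowerUnits 2∣∑))
    palindromic-realizable (inj₁ 2∣∑) | odd _ c _ fixed split = evenRealizable (fixed , split) 2∣∑
    -- A large central entry does not exclude an even first-half sum. Parity is therefore decided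
    -- here, and the centre is drawn on only when a unit is left over.
    palindromic-realizable (inj₂ (_ , d , d-at , 2≤rd)) | odd _ c c-at fixed split
      with 2 ℕ.∣? sum (r ∘ lower)
    ... | yes 2∣∑ = evenRealizable (fixed , split) 2∣∑
    ... | no 2∤∑ = oddRealizable (fixed , split) (subst (λ i → 2 ≤ r i) d≡c 2≤rd) 2∤∑
      where
      d≡c : d ≡ c
      d≡c = toℕ-injective (ℕ.suc-injective (trans d-at (sym c-at)))

open import Data.Integer.Base using (+_)
open import Defs

-- Order, embedded integers and halving for the Cauchy reals.

module _ where
  open ≡ using (refl; sym; trans)

  half>0 : ∀ {ε} → 0ℚ ℚ.< ε → 0ℚ ℚ.< ½ ℚ.* ε
  half>0 {ε} 0<ε = subst (ℚ._< ½ ℚ.* ε) (ℚ.*-zeroʳ ½) (ℚ.*-monoʳ-<-pos ½ 0<ε)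

  double>0 : ∀ {ε} → 0ℚ ℚ.< ε → 0ℚ ℚ.< ε ℚ.+ ε
  double>0 0<ε = ℚ.+-mono-< 0<ε 0<ε

  half-distrib : ∀ p → ½ ℚ.* p ℚ.+ ½ ℚ.* p ≡ p
  half-distrib p = trans (sym (ℚ.*-distribʳ-+ p ½ ½)) (ℚ.*-identityˡ p)

  half-double : ∀ p → ½ ℚ.* (p ℚ.+ p) ≡ p
  half-double p = trans (ℚ.*-distribˡ-+ ½ p p) (half-distrib p)

  p≤∣p∣ : ∀ p → p ℚ.≤ ∣ p ∣
  p≤∣p∣ p with ℚ.≤-total p 0ℚ
  ... | inj₁ p≤0 = ℚ.≤-trans p≤0 (ℚ.0≤∣p∣ p)
  ... | inj₂ 0≤p = ℚ.≤-reflexive (sym (ℚ.0≤p⇒∣p∣≡p 0≤p))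

  p<q⇒0<q-p : ∀ {p q} → p ℚ.< q → 0ℚ ℚ.< q ℚ.- p
  p<q⇒0<q-p {p} {q} p<q = subst (ℚ._< q ℚ.- p) (ℚ.+-inverseʳ p) (ℚ.+-monoˡ-< (ℚ.- p) p<q)

  q+[p-q]≡p : ∀ p q → q ℚ.+ (p ℚ.- q) ≡ p
  q+[p-q]≡p = solve 2 (λ p q → q :+ (p :- q) := p) refl
    where open +-*-Solver

  ∣p-q∣<ε⇒p<q+ε : ∀ p q {ε} → ∣ p ℚ.- q ∣ ℚ.< ε → p ℚ.< q ℚ.+ ε
  ∣p-q∣<ε⇒p<q+ε p q {ε} near = subst (ℚ._< q ℚ.+ ε) (q+[p-q]≡p p q)
    (ℚ.+-monoʳ-< q (ℚ.≤-<-trans (p≤∣p∣ (p ℚ.- q)) near))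

  ≤-respʳ-≈ : ∀ {x y z} → y ≈ z → x ≤ y → x ≤ z
  ≤-respʳ-≈ {x} {y} {z} y≈z x≤y ε 0<ε
    with x≤y (½ ℚ.* ε) (half>0 0<ε) | y≈z (½ ℚ.* ε) (half>0 0<ε)
  ... | M , f | N , g = M ℕ.⊔ N , λ n M⊔N≤n → let open ℚ.≤-Reasoning in begin-strict
    seq x n                               <⟨ f n (ℕ.m⊔n≤o⇒m≤o M N M⊔N≤n) ⟩
    seq y n ℚ.+ ½ ℚ.* ε                   <⟨ ℚ.+-monoˡ-< (½ ℚ.* ε)
                                               (∣p-q∣<ε⇒p<q+ε (seq y n) (seq z n) (g n (ℕ.m⊔n≤o⇒n≤o M N M⊔N≤n))) ⟩
    (seq z n ℚ.+ ½ ℚ.* ε) ℚ.+ ½ ℚ.* ε     ≡⟨ ℚ.+-assoc (seq z n) (½ ℚ.* ε) (½ ℚ.* ε) ⟩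
    seq z n ℚ.+ (½ ℚ.* ε ℚ.+ ½ ℚ.* ε)     ≡⟨ cong (seq z n ℚ.+_) (half-distrib ε) ⟩
    seq z n ℚ.+ ε                         ∎

  0≤x+y : ∀ {x y} → 0ℝ ≤ x → 0ℝ ≤ y → 0ℝ ≤ x + y
  0≤x+y {x} {y} 0≤x 0≤y ε 0<ε
    with 0≤x (½ ℚ.* ε) (half>0 0<ε) | 0≤y (½ ℚ.* ε) (half>0 0<ε)
  ... | M , f | N , g = M ℕ.⊔ N , λ n M⊔N≤n → subst (0ℚ ℚ.<_)
    (trans (interchange (seq x n) (½ ℚ.* ε) (seq y n) (½ ℚ.* ε))
      (cong (seq x n ℚ.+ seq y n ℚ.+_) (half-distrib ε)))
    (ℚ.+-mono-< (f n (ℕ.m⊔n≤o⇒m≤o M N M⊔N≤n)) (g n (ℕ.m⊔n≤o⇒n≤o M N M⊔N≤n)))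
    where
    open +-*-Solver
    interchange : ∀ p q r s → (p ℚ.+ q) ℚ.+ (r ℚ.+ s) ≡ (p ℚ.+ r) ℚ.+ (q ℚ.+ s)
    interchange = solve 4 (λ p q r s → (p :+ q) :+ (r :+ s) := (p :+ r) :+ (q :+ s)) refl

  fromℚ-mono-≤ : ∀ {p q} → p ℚ.≤ q → fromℚ p ≤ fromℚ q
  fromℚ-mono-≤ {p} {q} p≤q ε 0<ε = 0 , λ _ _ →
    subst (ℚ._< q ℚ.+ ε) (ℚ.+-identityʳ p) (ℚ.+-mono-≤-< p≤q 0<ε)

  fromℚ-cancel-≤ : ∀ {p q} → fromℚ p ≤ fromℚ q → p ℚ.≤ q
  fromℚ-cancel-≤ {p} {q} p≤q = ℚ.≮⇒≥ λ q<p →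
    -- With the gap `p - q` as tolerance, the constant sequences give `p < q + (p - q)`, that is
    -- `p < p`.
    let N , below = p≤q (p ℚ.- q) (p<q⇒0<q-p q<p) in
    ℚ.<-irrefl (sym (q+[p-q]≡p p q)) (below N ℕ.≤-refl)

  ≈⇒≤ : ∀ {x y} → x ≈ y → x ≤ y
  ≈⇒≤ {x} {y} x≈y ε 0<ε = let N , near = x≈y ε 0<ε in
    N , λ n N≤n → ∣p-q∣<ε⇒p<q+ε (seq x n) (seq y n) (near n N≤n)

  fromℚ-injective : ∀ {p q} → fromℚ p ≈ fromℚ q → p ≡ q
  fromℚ-injective {p} {q} p≈q = ℚ.≤-antisym
    (fromℚ-cancel-≤ (≈⇒≤ {fromℚ p} {fromℚ q} p≈q))
    (fromℚ-cancel-≤ (≈⇒≤ {fromℚ q} {fromℚ p} (≈-sym {fromℚ p} {fromℚ q} p≈q)))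

  -- For a variable `i` the fraction `i / 1` is stuck in normalisation, whereas the literal is a
  -- record whose numerator is `i`. Comparisons of embedded integers pass through the literal.
  i/1≡i : ∀ i → i ℚ./ 1 ≡ Literals.fromℤ i
  i/1≡i i = ℚ.↥p/↧p≡p (Literals.fromℤ i)

  fromℤ-injective : ∀ {i j} → fromℤ i ≈ fromℤ j → i ≡ j
  fromℤ-injective {i} {j} i≈j = cong ℚ.numerator
    (trans (sym (i/1≡i i)) (trans (fromℚ-injective i≈j) (i/1≡i j)))

  fromℤ-mono-≤ : ∀ {i j} → i ℤ.≤ j → fromℤ i ≤ fromℤ j
  fromℤ-mono-≤ {i} {j} i≤j = fromℚ-mono-≤ (ℚ.≤-trans (ℚ.≤-reflexive (i/1≡i i))
    (ℚ.≤-trans (ℚ.*≤* (ℤ.*-monoʳ-≤-nonNeg (+ 1) i≤j)) (ℚ.≤-reflexive (sym (i/1≡i j)))))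

  fromℤ-cancel-≤ : ∀ {i j} → fromℤ i ≤ fromℤ j → i ℤ.≤ j
  fromℤ-cancel-≤ {i} {j} i≤j = ℤ.*-cancelʳ-≤-pos i j (+ 1) (ℚ.drop-*≤*
    (ℚ.≤-trans (ℚ.≤-reflexive (sym (i/1≡i i)))
      (ℚ.≤-trans (fromℚ-cancel-≤ i≤j) (ℚ.≤-reflexive (i/1≡i j)))))

  fromℤ-+ : ∀ i j → fromℤ (i ℤ.+ j) ≈ fromℤ i + fromℤ j
  fromℤ-+ i j = ≈-reflexive-seq {fromℤ (i ℤ.+ j)} {fromℤ i + fromℤ j} λ _ → begin
    (i ℤ.+ j) ℚ./ 1
      -- The sum of two fractions over 1 unfolds to `(i * 1 + j * 1) / 1`.
      ≡⟨ cong (ℚ._/ 1) (cong₂ ℤ._+_ (ℤ.*-identityʳ i) (ℤ.*-identityʳ j)) ⟨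
    Literals.fromℤ i ℚ.+ Literals.fromℤ j
      ≡⟨ cong₂ ℚ._+_ (i/1≡i i) (i/1≡i j) ⟨
    i ℚ./ 1 ℚ.+ j ℚ./ 1 ∎
    where open ≡-Reasoning

  -- Kept abstract because the type checker would otherwise compare reals by unfolding
  -- the normalisation of the rationals they consist of.
  abstract
    fromℕᵣ : ℕ → ℝ
    fromℕᵣ m = fromℤ (+ m)

    fromℕᵣ≡fromℤ : ∀ m → fromℕᵣ m ≡ fromℤ (+ m)
    fromℕᵣ≡fromℤ m = refl

    fromℕᵣ-0 : fromℕᵣ 0 ≈ 0ℝ
    fromℕᵣ-0 = ≈-refl {0ℝ}

    fromℕᵣ-+ : ∀ m n → fromℕᵣ (m ℕ.+ n) ≈ fromℕᵣ m + fromℕᵣ n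
    fromℕᵣ-+ m n = fromℤ-+ (+ m) (+ n)

    fromℕᵣ-injective : ∀ {m n} → fromℕᵣ m ≈ fromℕᵣ n → m ≡ n
    fromℕᵣ-injective {m} {n} m≈n = ℤ.+-injective (fromℤ-injective {+ m} {+ n} m≈n)

    fromℕᵣ-mono-≤ : ∀ {m n} → m ℕ.≤ n → fromℕᵣ m ≤ fromℕᵣ n
    fromℕᵣ-mono-≤ {m} {n} m≤n = fromℤ-mono-≤ {+ m} {+ n} (ℤ.+≤+ m≤n)

    fromℕᵣ-cancel-≤ : ∀ {m n} → fromℕᵣ m ≤ fromℕᵣ n → m ℕ.≤ n
    fromℕᵣ-cancel-≤ {m} {n} m≤n = ℤ.drop‿+≤+ (fromℤ-cancel-≤ {+ m} {+ n} m≤n)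

    fromℕᵣ-nonnegative : ∀ m → 0ℝ ≤ fromℕᵣ m
    fromℕᵣ-nonnegative m = fromℤ-mono-≤ {+ 0} {+ m} (ℤ.+≤+ z≤n)

  -- The embedding of the integers reflects the order, so the integer is itself nonnegative and
  -- equals its absolute value. This reduces the integral case to matrices of naturals.
  nonnegativeInteger⇒natural : ∀ {x} → 0ℝ ≤ x → IsInteger x → ∃[ m ] x ≈ fromℕᵣ m
  nonnegativeInteger⇒natural {x} 0≤x (i , x≈i) = ℤ.∣ i ∣ ,
    subst (x ≈_) (trans (cong fromℤ (sym (ℤ.0≤i⇒+∣i∣≡i 0≤i))) (sym (fromℕᵣ≡fromℤ ℤ.∣ i ∣))) x≈i
    where
    0≤i : + 0 ℤ.≤ i
    0≤i = fromℤ-cancel-≤ {+ 0} {i} (≤-respʳ-≈ {0ℝ} {x} {fromℤ i} x≈i 0≤x)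

  -- Halving halves distances, so `halfℝ` attains tolerance `ε` by asking its argument for `ε + ε`.
  ∣p-q∣<ε+ε⇒∣½p-½q∣<ε : ∀ p q {ε} → ∣ p ℚ.- q ∣ ℚ.< ε ℚ.+ ε → ∣ ½ ℚ.* p ℚ.- ½ ℚ.* q ∣ ℚ.< ε
  ∣p-q∣<ε+ε⇒∣½p-½q∣<ε p q {ε} near = begin-strict
    ∣ ½ ℚ.* p ℚ.- ½ ℚ.* q ∣ ≡⟨ cong ∣_∣ (factor p q) ⟩
    ∣ ½ ℚ.* (p ℚ.- q) ∣     ≡⟨ ℚ.∣p*q∣≡∣p∣*∣q∣ ½ (p ℚ.- q) ⟩
    ½ ℚ.* ∣ p ℚ.- q ∣       <⟨ ℚ.*-monoʳ-<-pos ½ near ⟩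
    ½ ℚ.* (ε ℚ.+ ε)         ≡⟨ half-double ε ⟩
    ε                       ∎
    where
    open ℚ.≤-Reasoning
    open +-*-Solver
    factor : ∀ p q → ½ ℚ.* p ℚ.- ½ ℚ.* q ≡ ½ ℚ.* (p ℚ.- q)
    factor = solve 2 (λ p q → con ½ :* p :- con ½ :* q := con ½ :* (p :- q)) refl

  abstract
    halfℝ : ℝ → ℝ
    halfℝ x = mkℝ (λ n → ½ ℚ.* seq x n) λ ε 0<ε →
      let N , near = cauchy x (ε ℚ.+ ε) (double>0 0<ε) in
      N , λ m n N≤m N≤n → ∣p-q∣<ε+ε⇒∣½p-½q∣<ε (seq x m) (seq x n) (near m n N≤m N≤n)

    halfℝ+halfℝ : ∀ x → halfℝ x + halfℝ x ≈ x
    halfℝ+halfℝ x = ≈-reflexive-seq {halfℝ x + halfℝ x} {x} λ n → half-distrib (seq x n)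

    halfℝ-nonnegative : ∀ {x} → 0ℝ ≤ x → 0ℝ ≤ halfℝ x
    halfℝ-nonnegative {x} 0≤x ε 0<ε = let N , f = 0≤x (ε ℚ.+ ε) (double>0 0<ε) in
      N , λ n N≤n → subst (0ℚ ℚ.<_)
        (trans (ℚ.*-distribˡ-+ ½ (seq x n) (ε ℚ.+ ε)) (cong (½ ℚ.* seq x n ℚ.+_) (half-double ε)))
        (subst (ℚ._< ½ ℚ.* (seq x n ℚ.+ (ε ℚ.+ ε))) (ℚ.*-zeroʳ ½) (ℚ.*-monoʳ-<-pos ½ (f n N≤n)))

    halfℝ-cong : ∀ {x y} → x ≈ y → halfℝ x ≈ halfℝ y
    halfℝ-cong {x} {y} x≈y ε 0<ε =
      let N , near = x≈y (ε ℚ.+ ε) (double>0 0<ε) in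
      N , λ n N≤n → ∣p-q∣<ε+ε⇒∣½p-½q∣<ε (seq x n) (seq y n) (near n N≤n)

  -- Sums of embedded naturals and entries of the diagonal matrix.

  private
    module Σℕ = Sum ℕ.+-0-commutativeMonoid
    module Σℝ = Sum +-0-commutativeMonoid

  open import Relation.Binary.Reasoning.Setoid (CommutativeMonoid.setoid +-0-commutativeMonoid)

  fromℕᵣ-sum : ∀ {n} (f : Vector ℕ n) → fromℕᵣ (Σℕ.sum f) ≈ sum (λ i → fromℕᵣ (f i))
  fromℕᵣ-sum {zero}  f = fromℕᵣ-0
  fromℕᵣ-sum {suc n} f = begin
    fromℕᵣ (f zero ℕ.+ Σℕ.sum (tail f))
      ≈⟨ fromℕᵣ-+ (f zero) (Σℕ.sum (tail f)) ⟩
    fromℕᵣ (f zero) + fromℕᵣ (Σℕ.sum (tail f))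
      ≈⟨ +-cong {fromℕᵣ (f zero)} {fromℕᵣ (f zero)} {fromℕᵣ (Σℕ.sum (tail f))}
           {sum (λ i → fromℕᵣ (tail f i))} (≈-refl {fromℕᵣ (f zero)}) (fromℕᵣ-sum (tail f)) ⟩
    sum (λ i → fromℕᵣ (f i)) ∎

  sum-naturals : ∀ {n} (x : Vector ℝ n) (f : Vector ℕ n) →
    (∀ i → x i ≈ fromℕᵣ (f i)) → sum x ≈ fromℕᵣ (Σℕ.sum f)
  sum-naturals {n} x f x≈f = begin
    sum x                    ≈⟨ Σℝ.sum-cong-≋ {n} {x} {λ i → fromℕᵣ (f i)} x≈f ⟩
    sum (λ i → fromℕᵣ (f i)) ≈⟨ fromℕᵣ-sum f ⟨
    fromℕᵣ (Σℕ.sum f)        ∎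

  firstHalfSum-naturals : ∀ {n} (R : Vector ℝ n) (f : Vector ℕ n) →
    (∀ i → R i ≈ fromℕᵣ (f i)) → firstHalfSum R ≈ fromℤ (+ Σℕ.sum (λ i → f (lower i)))
  firstHalfSum-naturals R f R≈f = begin
    firstHalfSum R                        ≡⟨⟩
    sum (λ i → R (lower i))               ≈⟨ sum-naturals (λ i → R (lower i)) (λ i → f (lower i)) (λ i → R≈f (lower i)) ⟩
    fromℕᵣ (Σℕ.sum (λ i → f (lower i)))   ≡⟨ fromℕᵣ≡fromℤ (Σℕ.sum (λ i → f (lower i))) ⟩
    fromℤ (+ Σℕ.sum (λ i → f (lower i)))  ∎

  diagonals-sum : ∀ {n} (x y : Vector ℝ n) → (∀ i → x i + x i ≈ y i) →
    ∀ i → sum (diagonals +-0-commutativeMonoid x i) ≈ y i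
  diagonals-sum x y x+x≈y i = begin
    sum (diagonals +-0-commutativeMonoid x i) ≈⟨ diagonals-rowSum +-0-commutativeMonoid x i ⟩
    x i + x i                                 ≈⟨ x+x≈y i ⟩
    y i                                       ∎

  single-nonnegative : ∀ {n x} (i j : Fin n) → 0ℝ ≤ x → 0ℝ ≤ single +-0-commutativeMonoid x i j
  single-nonnegative i j 0≤x with i ≟ j
  ... | yes _ = 0≤x
  ... | no _  = fromℚ-mono-≤ ℚ.≤-refl

  -- Both equivalences for real matrices.

  module _ {n} {R S : Vector ℝ n} where

    invariant⇒equal×palindromic : ∀ {A} → 𝒯^π/2 R S A → R ≋ S × Palindromic R
    invariant⇒equal×palindromic {A} (A∈𝒯 , invariant) =
      (λ j → begin
        R j               ≈⟨ rowSums j ⟨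
        sum (A j)         ≈⟨ columnSum≈rowSum +-0-commutativeMonoid A invariant j ⟨
        sum (λ i → A i j) ≈⟨ columnSums j ⟩
        S j               ∎) ,
      (λ i → begin
        R i                  ≈⟨ rowSums i ⟨
        sum (A i)            ≈⟨ rowSum-palindromic +-0-commutativeMonoid A invariant i ⟩
        sum (A (opposite i)) ≈⟨ rowSums (opposite i) ⟩
        R (opposite i)       ∎)
      where open 𝒯 A∈𝒯

    -- Invariance turns column sums into row sums, and `R ≋ S` does the rest. Hence both
    -- constructions supply row sums only, which is why `Realizable` records no column sums.
    invariant∈𝒯^π/2 : ∀ {A} → R ≋ S → (∀ i → Nonnegative (A i)) → ρ A ≋ₘ A →
      (∀ i → sum (A i) ≈ R i) → 𝒯^π/2 R S A
    invariant∈𝒯^π/2 {A} R≋S nonnegative invariant rowSums = record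
      { nonnegative = nonnegative
      ; rowSums     = rowSums
      ; columnSums  = λ j → begin
          sum (λ i → A i j) ≈⟨ columnSum≈rowSum +-0-commutativeMonoid A invariant j ⟩
          sum (A j)         ≈⟨ rowSums j ⟩
          R j               ≈⟨ R≋S j ⟩
          S j               ∎
      } , invariant

    equal×palindromic⇒invariant : Nonnegative R → R ≋ S × Palindromic R → Satisfiable (𝒯^π/2 R S)
    equal×palindromic⇒invariant 0≤R (R≋S , palindromic) =
      diagonals +-0-commutativeMonoid (λ i → halfℝ (R i)) ,
      invariant∈𝒯^π/2 {diagonals +-0-commutativeMonoid (λ i → halfℝ (R i))} R≋S
        (λ i j → 0≤x+y
          {single +-0-commutativeMonoid (halfℝ (R i)) i j}
          {single +-0-commutativeMonoid (halfℝ (R i)) i (opposite j)}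
          (single-nonnegative {n} {halfℝ (R i)} i j (halfℝ-nonnegative {R i} (0≤R i)))
          (single-nonnegative {n} {halfℝ (R i)} i (opposite j) (halfℝ-nonnegative {R i} (0≤R i))))
        (diagonals-invariant +-0-commutativeMonoid (λ i → halfℝ (R i))
          λ i → halfℝ-cong {R i} {R (opposite i)} (palindromic i))
        (diagonals-sum (λ i → halfℝ (R i)) R (λ i → halfℝ+halfℝ (R i)))

    -- Each entry is replaced by the natural number it equals. Injectivity of `fromℕᵣ` carries
    -- invariance over to `a`, and the resulting alternative is carried back along the row sums.
    integral⇒even⊎centre≥2 : ∀ {A} → 𝒯ℤ^π/2 R S A → IsEven (firstHalfSum R) ⊎ OddWithMiddle≥2 R
    integral⇒even⊎centre≥2 {A} ((A∈𝒯 , A-invariant) , integral) =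
      fromNaturals (upper-even⊎centre≥2 a a-invariant)
      where
      open 𝒯 A∈𝒯

      natural : ∀ i j → ∃[ m ] A i j ≈ fromℕᵣ m
      natural i j = nonnegativeInteger⇒natural {A i j} (nonnegative i j) (integral i j)

      a : Fin n → Fin n → ℕ
      a i j = proj₁ (natural i j)

      a-invariant : RotationInvariant a
      a-invariant i j = fromℕᵣ-injective {a j (opposite i)} {a i j} (begin
        fromℕᵣ (a j (opposite i)) ≈⟨ proj₂ (natural j (opposite i)) ⟨
        A j (opposite i)          ≈⟨ A-invariant i j ⟩
        A i j                     ≈⟨ proj₂ (natural i j) ⟩
        fromℕᵣ (a i j)            ∎)

      rows : ∀ i → R i ≈ fromℕᵣ (Σℕ.sum (a i))
      rows i = begin
        R i                    ≈⟨ rowSums i ⟨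
        sum (A i)              ≈⟨ sum-naturals (A i) (a i) (λ j → proj₂ (natural i j)) ⟩
        fromℕᵣ (Σℕ.sum (a i))  ∎

      fromNaturals :
        2 ℕ.∣ Σℕ.sum (λ i → Σℕ.sum (a (lower i))) ⊎
        (2 ℕ.∤ n × ∃[ c ] (suc (toℕ c) ≡ ⌈ n /2⌉ × 2 ℕ.≤ Σℕ.sum (a c))) →
        IsEven (firstHalfSum R) ⊎ OddWithMiddle≥2 R
      -- Divisibility of integers is by definition divisibility of absolute values, so the proof
      -- over the naturals is reused unchanged.
      fromNaturals (inj₁ 2∣∑) = inj₁
        (+ Σℕ.sum (λ i → Σℕ.sum (a (lower i))) , firstHalfSum-naturals R (λ i → Σℕ.sum (a i)) rows , 2∣∑)
      fromNaturals (inj₂ (2∤n , c , at , 2≤∑)) = inj₂ (2∤n , c , at ,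
        subst (_≤ R c) (fromℕᵣ≡fromℤ 2)
          (≤-respʳ-≈ {fromℕᵣ 2} {fromℕᵣ (Σℕ.sum (a c))} {R c}
            (≈-sym {R c} {fromℕᵣ (Σℕ.sum (a c))} (rows c)) (fromℕᵣ-mono-≤ 2≤∑)))

    even⊎centre≥2⇒integral : Nonnegative R → Integral R →
      R ≋ S × Palindromic R × (IsEven (firstHalfSum R) ⊎ OddWithMiddle≥2 R) →
      Satisfiable (𝒯ℤ^π/2 R S)
    even⊎centre≥2⇒integral 0≤R integral (R≋S , palindromic , condition) =
      let a , invariant , rows = palindromic-realizable r r-palindromic (r-condition condition) in
      (λ i j → fromℕᵣ (a i j)) ,
      invariant∈𝒯^π/2 {λ i j → fromℕᵣ (a i j)} R≋S
        (λ i j → fromℕᵣ-nonnegative (a i j))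
        (λ i j → begin
          fromℕᵣ (a j (opposite i)) ≡⟨ cong fromℕᵣ (invariant i j) ⟩
          fromℕᵣ (a i j)            ∎)
        (λ i → begin
          sum (λ j → fromℕᵣ (a i j)) ≈⟨ fromℕᵣ-sum (a i) ⟨
          fromℕᵣ (Σℕ.sum (a i))      ≡⟨ cong fromℕᵣ (rows i) ⟩
          fromℕᵣ (r i)               ≈⟨ R≈r i ⟨
          R i                        ∎) ,
      λ i j → + a i j , subst (fromℕᵣ (a i j) ≈_) (fromℕᵣ≡fromℤ (a i j)) (≈-refl {fromℕᵣ (a i j)})
      where
      natural : ∀ i → ∃[ m ] R i ≈ fromℕᵣ m
      natural i = nonnegativeInteger⇒natural {R i} (0≤R i) (integral i)

      r : Fin n → ℕ
      r i = proj₁ (natural i)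

      R≈r : ∀ i → R i ≈ fromℕᵣ (r i)
      R≈r i = proj₂ (natural i)

      r-palindromic : ∀ i → r i ≡ r (opposite i)
      r-palindromic i = fromℕᵣ-injective {r i} {r (opposite i)} (begin
        fromℕᵣ (r i)            ≈⟨ R≈r i ⟨
        R i                     ≈⟨ palindromic i ⟩
        R (opposite i)          ≈⟨ R≈r (opposite i) ⟩
        fromℕᵣ (r (opposite i)) ∎)

      r-condition : IsEven (firstHalfSum R) ⊎ OddWithMiddle≥2 R →
        2 ℕ.∣ Σℕ.sum (λ i → r (lower i)) ⊎ (2 ℕ.∤ n × ∃[ c ] (suc (toℕ c) ≡ ⌈ n /2⌉ × 2 ℕ.≤ r c))
      r-condition (inj₁ (i , ∑≈i , 2∣i)) = inj₁ (subst (2 ℕ.∣_) (cong ℤ.∣_∣ i≡∑) 2∣i)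
        where
        -- `IsEven` provides some integer `i` equal to the real sum; injectivity of `fromℤ`
        -- identifies it with the natural sum.
        i≡∑ : i ≡ + Σℕ.sum (λ i → r (lower i))
        i≡∑ = fromℤ-injective {i} {+ Σℕ.sum (λ i → r (lower i))} (begin
          fromℤ i                        ≈⟨ ∑≈i ⟨
          firstHalfSum R                 ≈⟨ firstHalfSum-naturals R r R≈r ⟩
          fromℤ (+ Σℕ.sum (λ i → r (lower i)))   ∎)
      r-condition (inj₂ (2∤n , c , at , 2≤Rc)) = inj₂ (2∤n , c , at ,
        fromℕᵣ-cancel-≤ (≤-respʳ-≈ {fromℕᵣ 2} {R c} {fromℕᵣ (r c)} (R≈r c)
          (subst (_≤ R c) (sym (fromℕᵣ≡fromℤ 2)) 2≤Rc)))

theorem15 : (n : ℕ) .{{_ : NonZero n}} (R S : Vector ℝ n) →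
    Nonnegative R → Nonnegative S → sum R ≈ sum S →
    (Satisfiable (𝒯^π/2 R S) ⇔ (R ≋ S × Palindromic R))
    ×
    (Integral R → Integral S →
    Satisfiable (𝒯ℤ^π/2 R S) ⇔
    (R ≋ S × Palindromic R × (IsEven (firstHalfSum R) ⊎ OddWithMiddle≥2 R)))
theorem15 n R S 0≤R _ _ =
  mk⇔ (λ (_ , A∈𝒯) → invariant⇒equal×palindromic A∈𝒯) (equal×palindromic⇒invariant 0≤R) ,
  λ integral _ → mk⇔
    (λ (_ , A∈𝒯ℤ@(A∈𝒯 , _)) → let R≋S , palindromic = invariant⇒equal×palindromic A∈𝒯 in
      R≋S , palindromic , integral⇒even⊎centre≥2 A∈𝒯ℤ)
    (even⊎centre≥2⇒integral 0≤R integral)
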